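{- Let $\lambda\in\mathbb{R}\setminus\{0\}$ and $x_1,x_2,y_1,y_2\in\mathbb{R}$. Then for every integer $n\ge0$, \[ C_{n,\lambda}(x_1+x_2,y_1+y_2)=\sum_{k=0}^{n}\binom{n}{k}\Big\{C_{n-k,\lambda}(x_1,y_1)C_{k,\lambda}(x_2,y_2)-S_{n-k,\lambda}(x_1,y_1)S_{k,\lambda}(x_2,y_2)\Big\} \] and \[ S_{n,\lambda}(x_1+x_2,y_1+y_2)=\sum_{k=0}^{n}\binom{n}{k}\Big\{S_{n-k,\lambda}(x_1,y_1)C_{k,\lambda}(x_2,y_2)+C_{n-k,\lambda}(x_1,y_1)S_{k,\lambda}(x_2,y_2)\Big\}. \]
   Context: All generating functions are formal power series in $t$. For $z\in\mathbb{C}$: $(z)_{0,\lambda}=1$ and $(z)_{n,\lambda}=z(z-\lambda)\cdots(z-(n-1)\lambda)$ for $n\ge1$. The degenerate exponential is $e_\lambda^{z}(t)=\sum_{n\ge0}(z)_{n,\lambda}\frac{t^n}{n!}$ (i.e. $(1+\lambda t)^{z/\lambda}$). The degenerate cosine and sine are $\cos_\lambda^{(y)}(t)=\frac{e_\lambda^{iy}(t)+e_\lambda^{ -iy}(t)}{2}$ and $\sin_\lambda^{(y)}(t)=\frac{e_\lambda^{iy}(t)-e_\lambda^{ -iy}(t)}{2i}$. The degenerate two-parametric polynomials $C_{n,\lambda}(x,y)$ and $S_{n,\lambda}(x,y)$ are defined by $e_\lambda^{x}(t)\cos_\lambda^{(y)}(t)=\sum_{n\ge0}C_{n,\lambda}(x,y)\frac{t^n}{n!}$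 and $e_\lambda^{x}(t)\sin_\lambda^{(y)}(t)=\sum_{n\ge0}S_{n,\lambda}(x,y)\frac{t^n}{n!}$. -}

module Defs where

open import Algebra.Bundles using (CommutativeRing)
open import Algebra.Structures using (IsCommutativeRing)
open import Data.Fin.Base using (toℕ)
open import Data.Integer.Base as ℤ using (+_)
import Data.Integer.Properties as ℤ
open import Data.Nat.Base as ℕ using (ℕ; zero; suc; _!; _∸_)
import Data.Nat.Properties as ℕ
open import Data.Product.Base using (∃-syntax; _×_; _,_)
open import Data.Rational.Base as ℚ using (ℚ; 0ℚ; 1ℚ; ½; ∣_∣; 1/_)
import Data.Rational.Properties as ℚ
import Data.Rational.Unnormalised.Base as ℚᵘ
import Data.Rational.Unnormalised.Properties as ℚᵘ
open import Data.Rational.Solver using (module +-*-Solver)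
open import Level using (0ℓ)
open import Relation.Binary.PropositionalEquality using (_≡_; refl; sym; trans; cong; subst)

-- A partial equivalence relation: `a ~ a` says that `a` is a Cauchy
-- sequence, and for Cauchy sequences `a ~ b` says that a − b tends to 0.
infix 4 _~_

_~_ : (ℕ → ℚ) → (ℕ → ℚ) → Set
a ~ b = ∀ ε → 0ℚ ℚ.< ε → ∃[ N ] ∀ m n → N ℕ.≤ m → N ℕ.≤ n → ∣ a m ℚ.- b n ∣ ℚ.< ε

module _ where
  open +-*-Solver

  private
    half+half : ∀ ε → ½ ℚ.* ε ℚ.+ ½ ℚ.* ε ≡ ε
    half+half = solve 1 (λ ε → con ½ :* ε :+ con ½ :* ε := ε) refl

    half-pos : ∀ {ε} → 0ℚ ℚ.< ε → 0ℚ ℚ.< ½ ℚ.* ε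
    half-pos = ℚ.*-monoʳ-<-pos ½

    triangle : ∀ {p q r ε} → r ≡ p ℚ.+ q → ∣ p ∣ ℚ.< ½ ℚ.* ε → ∣ q ∣ ℚ.< ½ ℚ.* ε → ∣ r ∣ ℚ.< ε
    triangle {p} {q} {r} {ε} r≡p+q p< q< = begin-strict
      ∣ r ∣                    ≡⟨ cong ∣_∣ r≡p+q ⟩
      ∣ p ℚ.+ q ∣              ≤⟨ ℚ.∣p+q∣≤∣p∣+∣q∣ p q ⟩
      ∣ p ∣ ℚ.+ ∣ q ∣          <⟨ ℚ.+-mono-< p< q< ⟩
      ½ ℚ.* ε ℚ.+ ½ ℚ.* ε      ≡⟨ half+half ε ⟩
      ε                        ∎
      where open ℚ.≤-Reasoning

  ~-sym : ∀ {a b} → a ~ b → b ~ a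
  ~-sym {a} {b} a~b ε 0<ε with a~b ε 0<ε
  ... | N , h = N , λ m n N≤m N≤n →
    subst (ℚ._< ε) (trans (sym (ℚ.∣-p∣≡∣p∣ _)) (cong ∣_∣ (flip (a n) (b m)))) (h n m N≤n N≤m)
    where
    flip : ∀ p q → ℚ.- (p ℚ.- q) ≡ q ℚ.- p
    flip = solve 2 (λ p q → :- (p :- q) := q :- p) refl

  ~-trans : ∀ {a b c} → a ~ b → b ~ c → a ~ c
  ~-trans {a} {b} {c} a~b b~c ε 0<ε with a~b (½ ℚ.* ε) (half-pos 0<ε) | b~c (½ ℚ.* ε) (half-pos 0<ε)
  ... | M , h | N , k = M ℕ.⊔ N , λ m n ≤m ≤n →
    triangle (split (a m) (b m) (c n)) (h m m (ℕ.m⊔n≤o⇒m≤o M N ≤m) (ℕ.m⊔n≤o⇒m≤o M N ≤m))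
                                       (k m n (ℕ.m⊔n≤o⇒n≤o M N ≤m) (ℕ.m⊔n≤o⇒n≤o M N ≤n))
    where
    split : ∀ p q r → p ℚ.- r ≡ (p ℚ.- q) ℚ.+ (q ℚ.- r)
    split = solve 3 (λ p q r → p :- r := (p :- q) :+ (q :- r)) refl

  ~-respʳ : ∀ {a b c} → (∀ n → b n ≡ c n) → a ~ b → a ~ c
  ~-respʳ {a} b≗c a~b ε 0<ε with a~b ε 0<ε
  ... | N , h = N , λ m n N≤m N≤n → subst (λ q → ∣ a m ℚ.- q ∣ ℚ.< ε) (b≗c n) (h m n N≤m N≤n)

  const~ : ∀ q → (λ _ → q) ~ (λ _ → q)
  const~ q ε 0<ε = 0 , λ _ _ _ _ → subst (λ r → ∣ r ∣ ℚ.< ε) (sym (ℚ.+-inverseʳ q)) 0<ε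

  +-~ : ∀ {a a′ b b′} → a ~ a′ → b ~ b′ → (λ n → a n ℚ.+ b n) ~ (λ n → a′ n ℚ.+ b′ n)
  +-~ {a} {a′} {b} {b′} a~ b~ ε 0<ε with a~ (½ ℚ.* ε) (half-pos 0<ε) | b~ (½ ℚ.* ε) (half-pos 0<ε)
  ... | M , h | N , k = M ℕ.⊔ N , λ m n ≤m ≤n →
    triangle (split (a m) (a′ n) (b m) (b′ n)) (h m n (ℕ.m⊔n≤o⇒m≤o M N ≤m) (ℕ.m⊔n≤o⇒m≤o M N ≤n))
                                               (k m n (ℕ.m⊔n≤o⇒n≤o M N ≤m) (ℕ.m⊔n≤o⇒n≤o M N ≤n))
    where
    split : ∀ p p′ q q′ → (p ℚ.+ q) ℚ.- (p′ ℚ.+ q′) ≡ (p ℚ.- p′) ℚ.+ (q ℚ.- q′)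
    split = solve 4 (λ p p′ q q′ → (p :+ q) :- (p′ :+ q′) := (p :- p′) :+ (q :- q′)) refl

  neg-~ : ∀ {a b} → a ~ b → (λ n → ℚ.- a n) ~ (λ n → ℚ.- b n)
  neg-~ {a} {b} a~b ε 0<ε with a~b ε 0<ε
  ... | N , h = N , λ m n N≤m N≤n →
    subst (ℚ._< ε) (trans (sym (ℚ.∣-p∣≡∣p∣ _)) (cong ∣_∣ (ℚ.neg-distrib-+ (a m) (ℚ.- b n)))) (h m n N≤m N≤n)

  private abstract
    bound : ∀ {a b} → a ~ b → ∃[ K ] 0ℚ ℚ.< K × (∃[ N ] ∀ m → N ℕ.≤ m → ∣ a m ∣ ℚ.≤ K)
    bound {a} {b} a~b with a~b 1ℚ (ℚ.positive⁻¹ 1ℚ)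
    ... | N , h = 1ℚ ℚ.+ ∣ b N ∣ , ℚ.+-mono-<-≤ (ℚ.positive⁻¹ 1ℚ) (ℚ.0≤∣p∣ (b N)) , N , λ m N≤m → begin
      ∣ a m ∣                        ≡⟨ cong ∣_∣ (split (a m) (b N)) ⟩
      ∣ (a m ℚ.- b N) ℚ.+ b N ∣      ≤⟨ ℚ.∣p+q∣≤∣p∣+∣q∣ (a m ℚ.- b N) (b N) ⟩
      ∣ a m ℚ.- b N ∣ ℚ.+ ∣ b N ∣    ≤⟨ ℚ.+-monoˡ-≤ ∣ b N ∣ (ℚ.<⇒≤ (h m N N≤m ℕ.≤-refl)) ⟩
      1ℚ ℚ.+ ∣ b N ∣                 ∎
      where
      open ℚ.≤-Reasoning
      split : ∀ p q → p ≡ (p ℚ.- q) ℚ.+ q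
      split = solve 2 (λ p q → p := (p :- q) :+ q) refl

    small : ∀ K ε → 0ℚ ℚ.< K → 0ℚ ℚ.< ε → ∃[ δ ] 0ℚ ℚ.< δ × (∀ p q → ∣ p ∣ ℚ.≤ K → ∣ q ∣ ℚ.< δ → ∣ p ℚ.* q ∣ ℚ.< ε)
    small K ε 0<K 0<ε = 1/K ℚ.* ε , 0<δ , λ p q p≤ q< → begin-strict
      ∣ p ℚ.* q ∣           ≡⟨ ℚ.∣p*q∣≡∣p∣*∣q∣ p q ⟩
      ∣ p ∣ ℚ.* ∣ q ∣       ≤⟨ ℚ.*-monoʳ-≤-nonNeg ∣ q ∣ {{ℚ.∣-∣-nonNeg q}} p≤ ⟩
      K ℚ.* ∣ q ∣           <⟨ ℚ.*-monoʳ-<-pos K q< ⟩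
      K ℚ.* (1/K ℚ.* ε)     ≡⟨ sym (ℚ.*-assoc K 1/K ε) ⟩
      (K ℚ.* 1/K) ℚ.* ε     ≡⟨ cong (ℚ._* ε) (ℚ.*-inverseʳ K) ⟩
      1ℚ ℚ.* ε              ≡⟨ ℚ.*-identityˡ ε ⟩
      ε                     ∎
      where
      open ℚ.≤-Reasoning
      instance
        K-pos : ℚ.Positive K
        K-pos = ℚ.positive 0<K
        K-nonZero : ℚ.NonZero K
        K-nonZero = ℚ.pos⇒nonZero K
        ε-pos : ℚ.Positive ε
        ε-pos = ℚ.positive 0<ε
      1/K : ℚ
      1/K = 1/ K
      0<δ : 0ℚ ℚ.< 1/K ℚ.* ε
      0<δ = ℚ.positive⁻¹ _ {{ℚ.pos*pos⇒pos 1/K {{ℚ.1/pos⇒pos K}} ε}}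

  private
    *-split : ∀ p p′ q q′ → p ℚ.* q ℚ.- p′ ℚ.* q′ ≡ p ℚ.* (q ℚ.- q′) ℚ.+ q′ ℚ.* (p ℚ.- p′)
    *-split = solve 4 (λ p p′ q q′ → p :* q :- p′ :* q′ := p :* (q :- q′) :+ q′ :* (p :- p′)) refl

  *-~ : ∀ {a a′ b b′} → a ~ a′ → b ~ b′ → (λ n → a n ℚ.* b n) ~ (λ n → a′ n ℚ.* b′ n)
  *-~ {a} {a′} {b} {b′} a~ b~ ε 0<ε =
    let K , 0<K , N₁ , ∣a∣≤K  = bound {a} {a′} a~
        L , 0<L , N₂ , ∣b′∣≤L = bound {b′} {b} (~-sym {b} {b′} b~)
        δ₁ , 0<δ₁ , h₁        = small K (½ ℚ.* ε) 0<K (half-pos 0<ε)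
        δ₂ , 0<δ₂ , h₂        = small L (½ ℚ.* ε) 0<L (half-pos 0<ε)
        N₃ , k₁               = b~ δ₁ 0<δ₁
        N₄ , k₂               = a~ δ₂ 0<δ₂
        M₁                    = N₁ ℕ.⊔ N₂
        M₂                    = N₃ ℕ.⊔ N₄
    in M₁ ℕ.⊔ M₂ , λ m n ≤m ≤n →
    let M₁≤m = ℕ.m⊔n≤o⇒m≤o M₁ M₂ ≤m
        M₁≤n = ℕ.m⊔n≤o⇒m≤o M₁ M₂ ≤n
        M₂≤m = ℕ.m⊔n≤o⇒n≤o M₁ M₂ ≤m
        M₂≤n = ℕ.m⊔n≤o⇒n≤o M₁ M₂ ≤n
    in triangle {a m ℚ.* (b m ℚ.- b′ n)} {b′ n ℚ.* (a m ℚ.- a′ n)} {a m ℚ.* b m ℚ.- a′ n ℚ.* b′ n} {ε}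
      (*-split (a m) (a′ n) (b m) (b′ n))
      (h₁ (a m) (b m ℚ.- b′ n) (∣a∣≤K m (ℕ.m⊔n≤o⇒m≤o N₁ N₂ M₁≤m))
        (k₁ m n (ℕ.m⊔n≤o⇒m≤o N₃ N₄ M₂≤m) (ℕ.m⊔n≤o⇒m≤o N₃ N₄ M₂≤n)))
      (h₂ (b′ n) (a m ℚ.- a′ n) (∣b′∣≤L n (ℕ.m⊔n≤o⇒n≤o N₁ N₂ M₁≤n))
        (k₂ m n (ℕ.m⊔n≤o⇒n≤o N₃ N₄ M₂≤m) (ℕ.m⊔n≤o⇒n≤o N₃ N₄ M₂≤n)))

-- Real numbers are Cauchy sequences of rationals, with the setoid equality _≈ᴿ_.
record ℝ : Set where
  no-eta-equality
  field
    seq    : ℕ → ℚ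
    cauchy : seq ~ seq

open ℝ

infix 4 _≈ᴿ_

record _≈ᴿ_ (x y : ℝ) : Set where
  constructor mk≈
  field
    seq-~ : seq x ~ seq y

open _≈ᴿ_

infixl 6 _+ᴿ_
infixl 7 _*ᴿ_
infix  8 -ᴿ_

_+ᴿ_ : ℝ → ℝ → ℝ
seq    (x +ᴿ y) n = seq x n ℚ.+ seq y n
cauchy (x +ᴿ y)   = +-~ {seq x} {seq x} {seq y} {seq y} (cauchy x) (cauchy y)

_*ᴿ_ : ℝ → ℝ → ℝ
seq    (x *ᴿ y) n = seq x n ℚ.* seq y n
cauchy (x *ᴿ y)   = *-~ {seq x} {seq x} {seq y} {seq y} (cauchy x) (cauchy y)

-ᴿ_ : ℝ → ℝ
seq    (-ᴿ x) n = ℚ.- seq x n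
cauchy (-ᴿ x)   = neg-~ {seq x} {seq x} (cauchy x)

fromℚ : ℚ → ℝ
seq    (fromℚ q) _ = q
cauchy (fromℚ q)   = const~ q

0ᴿ 1ᴿ : ℝ
0ᴿ = fromℚ 0ℚ
1ᴿ = fromℚ 1ℚ

≈ᴿ-pointwise : ∀ {x y} → (∀ n → seq x n ≡ seq y n) → x ≈ᴿ y
≈ᴿ-pointwise {x} {y} h = mk≈ (~-respʳ {seq x} {seq x} {seq y} h (cauchy x))

ℝ-isCommutativeRing : IsCommutativeRing _≈ᴿ_ _+ᴿ_ _*ᴿ_ -ᴿ_ 0ᴿ 1ᴿ
ℝ-isCommutativeRing = record
  { isRing = record
    { +-isAbelianGroup = record
      { isGroup = record
        { isMonoid = record
          { isSemigroup = record
            { isMagma = record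
              { isEquivalence = record
                { refl  = λ {x} → mk≈ (cauchy x)
                ; sym   = λ {x} {y} p → mk≈ (~-sym {seq x} {seq y} (seq-~ p))
                ; trans = λ {x} {y} {z} p q → mk≈ (~-trans {seq x} {seq y} {seq z} (seq-~ p) (seq-~ q))
                }
              ; ∙-cong = λ {x} {x′} {y} {y′} p q → mk≈ (+-~ {seq x} {seq x′} {seq y} {seq y′} (seq-~ p) (seq-~ q))
              }
            ; assoc = λ x y z → ≈ᴿ-pointwise λ n → ℚ.+-assoc (seq x n) (seq y n) (seq z n)
            }
          ; identity = (λ x → ≈ᴿ-pointwise λ n → ℚ.+-identityˡ (seq x n))
                     , (λ x → ≈ᴿ-pointwise λ n → ℚ.+-identityʳ (seq x n))
          }
        ; inverse = (λ x → ≈ᴿ-pointwise λ n → ℚ.+-inverseˡ (seq x n))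
                  , (λ x → ≈ᴿ-pointwise λ n → ℚ.+-inverseʳ (seq x n))
        ; ⁻¹-cong = λ {x} {y} p → mk≈ (neg-~ {seq x} {seq y} (seq-~ p))
        }
      ; comm = λ x y → ≈ᴿ-pointwise λ n → ℚ.+-comm (seq x n) (seq y n)
      }
    ; *-cong = λ {x} {x′} {y} {y′} p q → mk≈ (*-~ {seq x} {seq x′} {seq y} {seq y′} (seq-~ p) (seq-~ q))
    ; *-assoc = λ x y z → ≈ᴿ-pointwise λ n → ℚ.*-assoc (seq x n) (seq y n) (seq z n)
    ; *-identity = (λ x → ≈ᴿ-pointwise λ n → ℚ.*-identityˡ (seq x n))
                 , (λ x → ≈ᴿ-pointwise λ n → ℚ.*-identityʳ (seq x n))
    ; distrib = (λ x y z → ≈ᴿ-pointwise λ n → ℚ.*-distribˡ-+ (seq x n) (seq y n) (seq z n))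
              , (λ x y z → ≈ᴿ-pointwise λ n → ℚ.*-distribʳ-+ (seq x n) (seq y n) (seq z n))
    }
  ; *-comm = λ x y → ≈ᴿ-pointwise λ n → ℚ.*-comm (seq x n) (seq y n)
  }

ℝ-commutativeRing : CommutativeRing 0ℓ 0ℓ
ℝ-commutativeRing = record { isCommutativeRing = ℝ-isCommutativeRing }

record ℂ : Set where
  no-eta-equality
  field
    re im : ℝ

open ℂ

record _≈ᶜ_ (z w : ℂ) : Set where
  field
    re-≈ : re z ≈ᴿ re w
    im-≈ : im z ≈ᴿ im w

open _≈ᶜ_

_+ᶜ_ : ℂ → ℂ → ℂ
re (z +ᶜ w) = re z +ᴿ re w
im (z +ᶜ w) = im z +ᴿ im w

_*ᶜ_ : ℂ → ℂ → ℂ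
re (z *ᶜ w) = re z *ᴿ re w +ᴿ -ᴿ (im z *ᴿ im w)
im (z *ᶜ w) = re z *ᴿ im w +ᴿ im z *ᴿ re w

-ᶜ_ : ℂ → ℂ
re (-ᶜ z) = -ᴿ re z
im (-ᶜ z) = -ᴿ im z

fromℝ : ℝ → ℂ
re (fromℝ x) = x
im (fromℝ x) = 0ᴿ

i : ℂ
re i = 0ᴿ
im i = 1ᴿ

ℂ-isCommutativeRing : IsCommutativeRing _≈ᶜ_ _+ᶜ_ _*ᶜ_ -ᶜ_ (fromℝ 0ᴿ) (fromℝ 1ᴿ)
ℂ-isCommutativeRing = record
  { isRing = record
    { +-isAbelianGroup = record
      { isGroup = record
        { isMonoid = record
          { isSemigroup = record
            { isMagma = record
              { isEquivalence = record
                { refl  = record { re-≈ = R.refl ; im-≈ = R.refl }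
                ; sym   = λ p → record { re-≈ = R.sym (re-≈ p) ; im-≈ = R.sym (im-≈ p) }
                ; trans = λ p q → record { re-≈ = R.trans (re-≈ p) (re-≈ q) ; im-≈ = R.trans (im-≈ p) (im-≈ q) }
                }
              ; ∙-cong = λ p q → record { re-≈ = R.+-cong (re-≈ p) (re-≈ q) ; im-≈ = R.+-cong (im-≈ p) (im-≈ q) }
              }
            ; assoc = λ x y z → record { re-≈ = R.+-assoc _ _ _ ; im-≈ = R.+-assoc _ _ _ }
            }
          ; identity = (λ x → record { re-≈ = R.+-identityˡ _ ; im-≈ = R.+-identityˡ _ })
                     , (λ x → record { re-≈ = R.+-identityʳ _ ; im-≈ = R.+-identityʳ _ })
          }
        ; inverse = (λ x → record { re-≈ = R.-‿inverseˡ _ ; im-≈ = R.-‿inverseˡ _ })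
                  , (λ x → record { re-≈ = R.-‿inverseʳ _ ; im-≈ = R.-‿inverseʳ _ })
        ; ⁻¹-cong = λ p → record { re-≈ = R.-‿cong (re-≈ p) ; im-≈ = R.-‿cong (im-≈ p) }
        }
      ; comm = λ x y → record { re-≈ = R.+-comm _ _ ; im-≈ = R.+-comm _ _ }
      }
    ; *-cong = λ p q → record
      { re-≈ = R.+-cong (R.*-cong (re-≈ p) (re-≈ q)) (R.-‿cong (R.*-cong (im-≈ p) (im-≈ q)))
      ; im-≈ = R.+-cong (R.*-cong (re-≈ p) (im-≈ q)) (R.*-cong (im-≈ p) (re-≈ q))
      }
    ; *-assoc = λ x y z → record
      { re-≈ = ≈ᴿ-pointwise λ n →
          solve 6 (λ a b c d e f →
              (a :* c :+ :- (b :* d)) :* e :+ :- ((a :* d :+ b :* c) :* f)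
            := a :* (c :* e :+ :- (d :* f)) :+ :- (b :* (c :* f :+ d :* e))) refl
            (seq (re x) n) (seq (im x) n) (seq (re y) n) (seq (im y) n) (seq (re z) n) (seq (im z) n)
      ; im-≈ = ≈ᴿ-pointwise λ n →
          solve 6 (λ a b c d e f →
              (a :* c :+ :- (b :* d)) :* f :+ (a :* d :+ b :* c) :* e
            := a :* (c :* f :+ d :* e) :+ b :* (c :* e :+ :- (d :* f))) refl
            (seq (re x) n) (seq (im x) n) (seq (re y) n) (seq (im y) n) (seq (re z) n) (seq (im z) n)
      }
    ; *-identity = *-idˡ , λ z → record
      { re-≈ = ≈ᴿ-pointwise λ n →
          solve 2 (λ a b → a :* con 1ℚ :+ :- (b :* con 0ℚ) := a) refl (seq (re z) n) (seq (im z) n)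
      ; im-≈ = ≈ᴿ-pointwise λ n →
          solve 2 (λ a b → a :* con 0ℚ :+ b :* con 1ℚ := b) refl (seq (re z) n) (seq (im z) n)
      }
    ; distrib = distˡ , λ x y z → record
      { re-≈ = ≈ᴿ-pointwise λ n →
          solve 6 (λ a b c d e f →
              (c :+ e) :* a :+ :- ((d :+ f) :* b)
            := (c :* a :+ :- (d :* b)) :+ (e :* a :+ :- (f :* b))) refl
            (seq (re x) n) (seq (im x) n) (seq (re y) n) (seq (im y) n) (seq (re z) n) (seq (im z) n)
      ; im-≈ = ≈ᴿ-pointwise λ n →
          solve 6 (λ a b c d e f →
              (c :+ e) :* b :+ (d :+ f) :* a
            := (c :* b :+ d :* a) :+ (e :* b :+ f :* a)) refl
            (seq (re x) n) (seq (im x) n) (seq (re y) n) (seq (im y) n) (seq (re z) n) (seq (im z) n)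
      }
    }
  ; *-comm = λ x y → record
      { re-≈ = ≈ᴿ-pointwise λ n →
          solve 4 (λ a b c d → a :* c :+ :- (b :* d) := c :* a :+ :- (d :* b)) refl
            (seq (re x) n) (seq (im x) n) (seq (re y) n) (seq (im y) n)
      ; im-≈ = ≈ᴿ-pointwise λ n →
          solve 4 (λ a b c d → a :* d :+ b :* c := c :* b :+ d :* a) refl
            (seq (re x) n) (seq (im x) n) (seq (re y) n) (seq (im y) n)
      }
  }
  where
  module R = CommutativeRing ℝ-commutativeRing
  open +-*-Solver
  *-idˡ : ∀ z → (fromℝ 1ᴿ *ᶜ z) ≈ᶜ z
  *-idˡ z = record
    { re-≈ = ≈ᴿ-pointwise λ n →
        solve 2 (λ a b → con 1ℚ :* a :+ :- (con 0ℚ :* b) := a) refl (seq (re z) n) (seq (im z) n)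
    ; im-≈ = ≈ᴿ-pointwise λ n →
        solve 2 (λ a b → con 1ℚ :* b :+ con 0ℚ :* a := b) refl (seq (re z) n) (seq (im z) n)
    }
  distˡ : ∀ x y z → (x *ᶜ (y +ᶜ z)) ≈ᶜ ((x *ᶜ y) +ᶜ (x *ᶜ z))
  distˡ x y z = record
    { re-≈ = ≈ᴿ-pointwise λ n →
        solve 6 (λ a b c d e f →
            a :* (c :+ e) :+ :- (b :* (d :+ f))
          := (a :* c :+ :- (b :* d)) :+ (a :* e :+ :- (b :* f))) refl
          (seq (re x) n) (seq (im x) n) (seq (re y) n) (seq (im y) n) (seq (re z) n) (seq (im z) n)
    ; im-≈ = ≈ᴿ-pointwise λ n →
        solve 6 (λ a b c d e f →
            a :* (d :+ f) :+ b :* (c :+ e)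
          := (a :* d :+ b :* c) :+ (a :* f :+ b :* e)) refl
          (seq (re x) n) (seq (im x) n) (seq (re y) n) (seq (im y) n) (seq (re z) n) (seq (im z) n)
    }

ℂ-commutativeRing : CommutativeRing 0ℓ 0ℓ
ℂ-commutativeRing = record { isCommutativeRing = ℂ-isCommutativeRing }

open CommutativeRing ℂ-commutativeRing public using (_≈_; _+_; _*_; -_; _-_; 0#; 1#)
open import Algebra.Properties.Semiring.Sum (CommutativeRing.semiring ℂ-commutativeRing) public using (sum-syntax; sum⁺-syntax)
open import Algebra.Properties.Semiring.Mult (CommutativeRing.semiring ℂ-commutativeRing) public using () renaming (_×_ to _·_)

-- `f n` is the coefficient of tⁿ.
PowerSeries : Set
PowerSeries = ℕ → ℂ

infix  4 _≋_
infixl 6 _⊕_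
infixl 7 _⊛_ _⊙_
infix  8 ⊖_

_≋_ : PowerSeries → PowerSeries → Set
f ≋ g = ∀ n → f n ≈ g n

_⊕_ : PowerSeries → PowerSeries → PowerSeries
(f ⊕ g) n = f n + g n

⊖_ : PowerSeries → PowerSeries
(⊖ f) n = - f n

_⊙_ : ℂ → PowerSeries → PowerSeries
(c ⊙ f) n = c * f n

_⊛_ : PowerSeries → PowerSeries → PowerSeries
(f ⊛ g) n = ∑[ k ≤ n ] (f (n ∸ toℕ k) * g (toℕ k))

1/_! : ℕ → ℂ
1/ n ! = fromℝ (fromℚ (ℚ._/_ (+ 1) (n !) {{n ℕ.!≢0}}))

-- egf a = Σₙ aₙ tⁿ/n!, and egf⁻¹ f is the unique a with f = egf a.
egf : (ℕ → ℂ) → PowerSeries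
egf a n = a n * 1/ n !

egf⁻¹ : PowerSeries → (ℕ → ℂ)
egf⁻¹ f n = (n !) · f n

-- ƛ stands for λ throughout: fall ƛ z n = z (z − λ) ⋯ (z − (n − 1) λ).
fall : ℝ → ℂ → ℕ → ℂ
fall ƛ z zero    = 1#
fall ƛ z (suc n) = fall ƛ z n * (z - n · fromℝ ƛ)

dexp : ℝ → ℂ → PowerSeries
dexp ƛ z = egf (fall ƛ z)

-- 1/(2i) = −i/2
1/2 1/2i : ℂ
1/2 = fromℝ (fromℚ ½)
1/2i = - (i * 1/2)

dcos : ℝ → ℝ → PowerSeries
dcos ƛ y = 1/2 ⊙ (dexp ƛ (i * fromℝ y) ⊕ dexp ƛ (- (i * fromℝ y)))

dsin : ℝ → ℝ → PowerSeries
dsin ƛ y = 1/2i ⊙ (dexp ƛ (i * fromℝ y) ⊕ ⊖ dexp ƛ (- (i * fromℝ y)))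

𝐂 𝐒 : ℝ → ℕ → ℝ → ℝ → ℂ
𝐂 ƛ n x y = egf⁻¹ (dexp ƛ (fromℝ x) ⊛ dcos ƛ y) n
𝐒 ƛ n x y = egf⁻¹ (dexp ƛ (fromℝ x) ⊛ dsin ƛ y) n

-- Validation of the conventions: 1/2, 1/2i and 1/ n ! are the reciprocals
-- they are named after, egf⁻¹ inverts egf, and therefore 𝐂 and 𝐒 are the
-- sequences whose exponential generating functions are the given products.
module _ where
  open CommutativeRing ℂ-commutativeRing using (setoid; semiring; *-congˡ; *-identityʳ; +-cong) renaming (refl to ≈-refl; trans to ≈-trans)
  open import Algebra.Properties.Semiring.Mult semiring using (×-assoc-*; ×-comm-*)
  open import Relation.Binary.Reasoning.Setoid setoid

  2*1/2≈1 : (1# + 1#) * 1/2 ≈ 1#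
  2*1/2≈1 = record { re-≈ = ≈ᴿ-pointwise λ _ → refl ; im-≈ = ≈ᴿ-pointwise λ _ → refl }

  2i*1/2i≈1 : ((1# + 1#) * i) * 1/2i ≈ 1#
  2i*1/2i≈1 = record { re-≈ = ≈ᴿ-pointwise λ _ → refl ; im-≈ = ≈ᴿ-pointwise λ _ → refl }

  private
    nat : ℕ → ℚ
    nat zero    = 0ℚ
    nat (suc n) = 1ℚ ℚ.+ nat n

    ·1/ : ∀ n q → n · fromℝ (fromℚ q) ≈ fromℝ (fromℚ (nat n ℚ.* q))
    ·1/ zero q = record { re-≈ = ≈ᴿ-pointwise λ _ → sym (ℚ.*-zeroˡ q) ; im-≈ = ≈ᴿ-pointwise λ _ → refl }
    ·1/ (suc n) q = ≈-trans (+-cong ≈-refl (·1/ n q)) (record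
      { re-≈ = ≈ᴿ-pointwise λ _ → solve 2 (λ a q → q :+ a :* q := (con 1ℚ :+ a) :* q) refl (nat n) q
      ; im-≈ = ≈ᴿ-pointwise λ _ → refl })
      where open +-*-Solver

    nat≃ : ∀ n → ℚ.toℚᵘ (nat n) ℚᵘ.≃ ℚᵘ.mkℚᵘ (+ n) 0
    nat≃ zero    = ℚᵘ.≃-refl
    nat≃ (suc n) = ℚᵘ.≃-trans (ℚ.toℚᵘ-homo-+ 1ℚ (nat n)) (ℚᵘ.≃-trans (ℚᵘ.+-congʳ ℚᵘ.1ℚᵘ (nat≃ n)) (ℚᵘ.*≡* (cong (λ k → (+ 1 ℤ.+ k) ℤ.* + 1) (ℤ.*-identityʳ (+ n)))))

    nat*1/ : ∀ n .{{_ : ℕ.NonZero n}} → nat n ℚ.* (+ 1 ℚ./ n) ≡ 1ℚ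
    nat*1/ n@(suc m) = ℚ.toℚᵘ-injective
      (ℚᵘ.≃-trans (ℚ.toℚᵘ-homo-* (nat n) (+ 1 ℚ./ n))
      (ℚᵘ.≃-trans (ℚᵘ.*-cong (nat≃ n) (ℚ.toℚᵘ-fromℚᵘ (ℚᵘ.mkℚᵘ (+ 1) m)))
      (ℚᵘ.*≡* (cong (λ k → + k) (trans (ℕ.*-identityʳ _) (trans (ℕ.*-identityʳ n) (sym (trans (ℕ.+-identityʳ _) (ℕ.+-identityʳ _)))))))))

  n!·1/n!≈1 : ∀ n → (n !) · (1/ n !) ≈ 1#
  n!·1/n!≈1 n = ≈-trans (·1/ (n !) (ℚ._/_ (+ 1) (n !) {{n ℕ.!≢0}})) (record
    { re-≈ = ≈ᴿ-pointwise λ _ → nat*1/ (n !) {{n ℕ.!≢0}}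
    ; im-≈ = ≈ᴿ-pointwise λ _ → refl })

  egf-egf⁻¹ : ∀ f → egf (egf⁻¹ f) ≋ f
  egf-egf⁻¹ f n = begin
    ((n !) · f n) * 1/ n !   ≈⟨ ×-assoc-* (n !) (f n) (1/ n !) ⟩
    (n !) · (f n * 1/ n !)   ≈⟨ ×-comm-* (n !) (f n) (1/ n !) ⟨
    f n * ((n !) · 1/ n !)   ≈⟨ *-congˡ (n!·1/n!≈1 n) ⟩
    f n * 1#                 ≈⟨ *-identityʳ (f n) ⟩
    f n                      ∎

  egf⁻¹-egf : ∀ a → egf⁻¹ (egf a) ≋ a
  egf⁻¹-egf a n = begin
    (n !) · (a n * 1/ n !)   ≈⟨ ×-comm-* (n !) (a n) (1/ n !) ⟨
    a n * ((n !) · 1/ n !)   ≈⟨ *-congˡ (n!·1/n!≈1 n) ⟩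
    a n * 1#                 ≈⟨ *-identityʳ (a n) ⟩
    a n                      ∎

  𝐂-egf : ∀ ƛ x y → egf (λ n → 𝐂 ƛ n x y) ≋ dexp ƛ (fromℝ x) ⊛ dcos ƛ y
  𝐂-egf ƛ x y = egf-egf⁻¹ (dexp ƛ (fromℝ x) ⊛ dcos ƛ y)

  𝐒-egf : ∀ ƛ x y → egf (λ n → 𝐒 ƛ n x y) ≋ dexp ƛ (fromℝ x) ⊛ dsin ƛ y
  𝐒-egf ƛ x y = egf-egf⁻¹ (dexp ƛ (fromℝ x) ⊛ dsin ƛ y)

{-# OPTIONS --safe #-}

-- Write z = x + iy and z̄ = x − iy.  Vandermonde's identity for the degenerate
-- falling factorials says e_λ^z(t) e_λ^w(t) = e_λ^{z+w}(t), so
--   C_n(x,y) = ½ (z)_{n,λ} + ½ (z̄)_{n,λ},   S_n(x,y) = (1/2i) (z)_{n,λ} − (1/2i) (z̄)_{n,λ}.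
-- In C C′ − S S′ and S C′ + C S′ the mixed products (z)(z̄′) and (z̄)(z′) cancel,
-- and Vandermonde's identity sums what is left.
module Submission where

open import Algebra.Bundles using (CommutativeRing; CommutativeSemiring)
open import Data.Fin.Base using (Fin; toℕ; fromℕ; inject₁)
open import Data.Fin.Properties using (toℕ-fromℕ; toℕ-inject₁; toℕ≤pred[n])
open import Data.Nat.Base as ℕ using (ℕ; zero; suc; _∸_; _!; _≤_)
open import Data.Nat.Combinatorics using (_C_; nCk≡n!/k![n-k]!; k>n⇒nCk≡0; k![n∸k]!∣n!; nCk+nC[k+1]≡[n+1]C[k+1])
open import Data.Nat.DivMod using (m/n*n≡m)
import Data.Nat.Properties as ℕ
open import Data.Product.Base using (_×_; _,_)
open import Relation.Binary.PropositionalEquality as ≡ using (_≡_)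
open import Relation.Nullary.Negation.Core using (¬_)

-- Binomial coefficients and binomial sums over a commutative semiring.

nCk*[k![n∸k]!]≡n! : ∀ {n k} → k ≤ n → (n C k) ℕ.* (k ! ℕ.* (n ∸ k) !) ≡ n !
nCk*[k![n∸k]!]≡n! {n} {k} k≤n =
  ≡.trans (≡.cong (ℕ._* (k ! ℕ.* (n ∸ k) !)) (nCk≡n!/k![n-k]! k≤n)) (m/n*n≡m (k![n∸k]!∣n! k≤n))
  where instance _ = k ℕ.!* (n ∸ k) !≢0

module BinomialSum {c ℓ} (R : CommutativeSemiring c ℓ) where
  open CommutativeSemiring R
  open import Algebra.Properties.Semiring.Sum semiring
  open import Algebra.Properties.Semiring.Mult semiring using (×-homo-+; ×-congˡ; ×-congʳ; ×-comm-*) renaming (_×_ to _·_)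
  open import Algebra.Properties.CommutativeMonoid.Mult +-commutativeMonoid using (×-distrib-+)
  open import Algebra.Solver.Ring.NaturalCoefficients.Default R using (solve; _:+_; _:*_; _:=_)
  open import Relation.Binary.Reasoning.Setoid setoid

  term : (ℕ → ℕ → Carrier) → (n : ℕ) → Fin (suc n) → Carrier
  term F n k = (n C toℕ k) · F (n ∸ toℕ k) (toℕ k)

  -- The summand depends on both `n ∸ k` and `k`, so that `∑C-suc` can raise either index on its
  -- own.
  ∑C : (ℕ → ℕ → Carrier) → ℕ → Carrier
  ∑C F n = sum (term F n)

  ∑C-cong : ∀ {F G} → (∀ m k → F m k ≈ G m k) → ∀ n → ∑C F n ≈ ∑C G n
  ∑C-cong F≈G n = sum-cong-≋ {suc n} λ k → ×-congʳ (n C toℕ k) (F≈G (n ∸ toℕ k) (toℕ k))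

  ∑C-+ : ∀ F G n → ∑C (λ m k → F m k + G m k) n ≈ ∑C F n + ∑C G n
  ∑C-+ F G n = trans
    (sum-cong-≋ {suc n} λ k → ×-distrib-+ (F (n ∸ toℕ k) (toℕ k)) (G (n ∸ toℕ k) (toℕ k)) (n C toℕ k))
    (∑-distrib-+ (term F n) (term G n))

  ∑C-* : ∀ x F n → ∑C (λ m k → x * F m k) n ≈ x * ∑C F n
  ∑C-* x F n = sym (trans
    (*-distribˡ-sum x (term F n))
    (sum-cong-≋ {suc n} λ k → ×-comm-* (n C toℕ k) x (F (n ∸ toℕ k) (toℕ k))))

  -- Pascal's rule, in the shape of Leibniz's rule for the derivative of a product. Each coefficient
  -- of row n + 1 is a sum of two neighbours in row n: one half raises the second index, the other
  -- half, after a shift of the summation index, raises the first.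
  ∑C-suc : ∀ F n → ∑C F (suc n) ≈ ∑C (λ m k → F (suc m) k + F m (suc k)) n
  ∑C-suc F n = begin
    F₀ + ∑[ k ≤ n ] ((suc n C suc (toℕ k)) · F (n ∸ toℕ k) (suc (toℕ k)))
      -- The term k = 0 has split off by computation; Pascal's rule applies to all the others.
      ≈⟨ +-congˡ (sum-cong-≋ {suc n} λ k → trans (×-congˡ (≡.sym (nCk+nC[k+1]≡[n+1]C[k+1] n (toℕ k)))) (×-homo-+ (F (n ∸ toℕ k) (suc (toℕ k))) (n C toℕ k) (n C suc (toℕ k)))) ⟩
    F₀ + ∑[ k ≤ n ] (right k + rest k)
      ≈⟨ +-congˡ (∑-distrib-+ {suc n} right rest) ⟩
    F₀ + (sum right + sum rest)
      ≈⟨ solve 3 (λ x y z → x :+ (y :+ z) := (x :+ z) :+ y) refl F₀ (sum right) (sum rest) ⟩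
    (F₀ + sum rest) + sum right
      -- `F₀ + sum rest` computes to `sum extended`, which runs over row n with one index too many.
      -- The surplus last entry has coefficient `n C suc n`, which is 0.
      ≈⟨ +-congʳ (sum-init-last extended) ⟩
    ((∑[ k ≤ n ] extended (inject₁ k)) + extended (fromℕ (suc n))) + sum right
      ≈⟨ +-congʳ (trans (+-congˡ extended-last) (+-identityʳ _)) ⟩
    (∑[ k ≤ n ] extended (inject₁ k)) + sum right
      ≈⟨ +-congʳ (sum-cong-≋ {suc n} extended-init) ⟩
    ∑C (λ m k → F (suc m) k) n + ∑C (λ m k → F m (suc k)) n
      ≈⟨ ∑C-+ (λ m k → F (suc m) k) (λ m k → F m (suc k)) n ⟨
    ∑C (λ m k → F (suc m) k + F m (suc k)) n ∎
    where
    F₀ : Carrier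
    F₀ = (suc n C 0) · F (suc n) 0
    right rest : Fin (suc n) → Carrier
    right k = (n C toℕ k) · F (n ∸ toℕ k) (suc (toℕ k))
    rest k = (n C suc (toℕ k)) · F (n ∸ toℕ k) (suc (toℕ k))
    extended : Fin (suc (suc n)) → Carrier
    extended k = (n C toℕ k) · F (suc n ∸ toℕ k) (toℕ k)
    extended-last : extended (fromℕ (suc n)) ≈ 0#
    extended-last = ×-congˡ (≡.trans (≡.cong (λ j → n C suc j) (toℕ-fromℕ n)) (k>n⇒nCk≡0 (ℕ.n<1+n n)))
    extended-init : ∀ k → extended (inject₁ k) ≈ (n C toℕ k) · F (suc (n ∸ toℕ k)) (toℕ k)
    extended-init k = reflexive (≡.trans
      (≡.cong (λ j → (n C j) · F (suc n ∸ j) j) (toℕ-inject₁ k))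
      (≡.cong (λ m → (n C toℕ k) · F m (toℕ k)) (ℕ.+-∸-assoc 1 (toℕ≤pred[n] k))))

  infixl 7 _⋆_

  -- Binomial convolution: what multiplication of exponential generating functions does to their
  -- coefficient sequences.
  _⋆_ : (ℕ → Carrier) → (ℕ → Carrier) → ℕ → Carrier
  a ⋆ b = ∑C (λ m k → a m * b k)

  -- Induction on n. `∑C-suc` multiplies the (m, k) summand by α m + β k, and additivity turns this
  -- factor into γ (m + k). Since m + k = n throughout the sum, the factor is constant and comes out
  -- as the one that takes c n to c (n + 1).
  vandermonde : ∀ {a b c α β γ : ℕ → Carrier} →
                a 0 ≈ 1# → b 0 ≈ 1# → c 0 ≈ 1# →
                (∀ n → a (suc n) ≈ a n * α n) → (∀ n → b (suc n) ≈ b n * β n) → (∀ n → c (suc n) ≈ c n * γ n) →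
                (∀ m k → γ (m ℕ.+ k) ≈ α m + β k) →
                ∀ n → (a ⋆ b) n ≈ c n
  vandermonde {a} {b} {c} {α} {β} {γ} a₀ b₀ c₀ a₊ b₊ c₊ γ₊ = go
    where
    go : ∀ n → (a ⋆ b) n ≈ c n
    go zero = trans (+-identityʳ _) (trans (+-identityʳ _) (trans (*-cong a₀ b₀) (trans (*-identityˡ 1#) (sym c₀))))
    go (suc n) = begin
      (a ⋆ b) (suc n)
        ≈⟨ ∑C-suc (λ m k → a m * b k) n ⟩
      ∑C (λ m k → a (suc m) * b k + a m * b (suc k)) n
        ≈⟨ ∑C-cong (λ m k → trans (+-cong (*-congʳ (a₊ m)) (*-congˡ (b₊ k)))
             (solve 4 (λ x u y v → x :* u :* y :+ x :* (y :* v) := x :* y :* (u :+ v)) refl (a m) (α m) (b k) (β k))) n ⟩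
      ∑C (λ m k → a m * b k * (α m + β k)) n
        -- `∑C-cong` does not suffice here: the rewriting needs (n ∸ k) + k = n, which relies on k ≤
        -- n.
        ≈⟨ sum-cong-≋ {suc n} (λ k → ×-congʳ (n C toℕ k) (*-congˡ {a (n ∸ toℕ k) * b (toℕ k)} (trans (sym (γ₊ (n ∸ toℕ k) (toℕ k)))
             (reflexive (≡.cong γ (ℕ.m∸n+n≡m (toℕ≤pred[n] k))))))) ⟩
      ∑C (λ m k → a m * b k * γ n) n
        ≈⟨ ∑C-cong (λ m k → *-comm (a m * b k) (γ n)) n ⟩
      ∑C (λ m k → γ n * (a m * b k)) n
        ≈⟨ ∑C-* (γ n) (λ m k → a m * b k) n ⟩
      γ n * (a ⋆ b) n
        ≈⟨ *-comm _ _ ⟩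
      (a ⋆ b) n * γ n
        ≈⟨ *-congʳ (go n) ⟩
      c n * γ n
        ≈⟨ c₊ n ⟨
      c (suc n) ∎

  -- Expanding the two products leaves four kinds of terms. The hypotheses give their coefficients
  -- in the order PP′, MM′, PM′, MP′; the last two vanish, so only convolutions of like with like
  -- survive.
  ∑C-diagonal : ∀ (P M P′ M′ : ℕ → Carrier) {a b c d e f g h p q} →
                a * c + e * g ≈ p → b * d + f * h ≈ q → a * d + e * h ≈ 0# → b * c + f * g ≈ 0# →
                ∀ n → ∑C (λ m k → (a * P m + b * M m) * (c * P′ k + d * M′ k) + (e * P m + f * M m) * (g * P′ k + h * M′ k)) n
                    ≈ p * (P ⋆ P′) n + q * (M ⋆ M′) n
  ∑C-diagonal P M P′ M′ {a} {b} {c} {d} {e} {f} {g} {h} {p} {q} pp mm pm mp n = begin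
    ∑C (λ m k → (a * P m + b * M m) * (c * P′ k + d * M′ k) + (e * P m + f * M m) * (g * P′ k + h * M′ k)) n
      ≈⟨ ∑C-cong (λ m k → pointwise (P m) (M m) (P′ k) (M′ k)) n ⟩
    ∑C (λ m k → p * (P m * P′ k) + q * (M m * M′ k)) n
      ≈⟨ ∑C-+ (λ m k → p * (P m * P′ k)) (λ m k → q * (M m * M′ k)) n ⟩
    ∑C (λ m k → p * (P m * P′ k)) n + ∑C (λ m k → q * (M m * M′ k)) n
      ≈⟨ +-cong (∑C-* p (λ m k → P m * P′ k) n) (∑C-* q (λ m k → M m * M′ k) n) ⟩
    p * (P ⋆ P′) n + q * (M ⋆ M′) n ∎
    where
    expand : ∀ a b c d e f g h x y x′ y′ →
      (a * x + b * y) * (c * x′ + d * y′) + (e * x + f * y) * (g * x′ + h * y′)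
      ≈ (a * c + e * g) * (x * x′) + (b * d + f * h) * (y * y′) + ((a * d + e * h) * (x * y′) + (b * c + f * g) * (y * x′))
    expand = solve 12 (λ a b c d e f g h x y x′ y′ →
      (a :* x :+ b :* y) :* (c :* x′ :+ d :* y′) :+ (e :* x :+ f :* y) :* (g :* x′ :+ h :* y′)
      := (a :* c :+ e :* g) :* (x :* x′) :+ (b :* d :+ f :* h) :* (y :* y′) :+ ((a :* d :+ e :* h) :* (x :* y′) :+ (b :* c :+ f :* g) :* (y :* x′))) refl
    pointwise : ∀ x y x′ y′ →
      (a * x + b * y) * (c * x′ + d * y′) + (e * x + f * y) * (g * x′ + h * y′) ≈ p * (x * x′) + q * (y * y′)
    pointwise x y x′ y′ = begin
      (a * x + b * y) * (c * x′ + d * y′) + (e * x + f * y) * (g * x′ + h * y′)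
        ≈⟨ expand a b c d e f g h x y x′ y′ ⟩
      (a * c + e * g) * (x * x′) + (b * d + f * h) * (y * y′) + ((a * d + e * h) * (x * y′) + (b * c + f * g) * (y * x′))
        ≈⟨ +-cong (+-cong (*-congʳ pp) (*-congʳ mm)) (+-cong (*-congʳ pm) (*-congʳ mp)) ⟩
      p * (x * x′) + q * (y * y′) + (0# * (x * y′) + 0# * (y * x′))
        ≈⟨ +-congˡ (trans (+-cong (zeroˡ _) (zeroˡ _)) (+-identityˡ 0#)) ⟩
      p * (x * x′) + q * (y * y′) + 0#
        ≈⟨ +-identityʳ _ ⟩
      p * (x * x′) + q * (y * y′) ∎

open import Defs
open CommutativeRing ℂ-commutativeRing
  using (setoid; semiring; commutativeSemiring; ring; +-abelianGroup; +-commutativeMonoid; +-commutativeSemigroup; *-commutativeSemigroup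
        ; refl; sym; trans; +-cong; +-congˡ; +-congʳ; *-cong; *-congˡ; *-congʳ; -‿cong; *-assoc; *-identityˡ; *-identityʳ; distribˡ)
open import Algebra.Properties.Ring ring using (-‿distribˡ-*; -‿distribʳ-*; -‿involutive)
open import Algebra.Properties.AbelianGroup +-abelianGroup using () renaming (⁻¹-∙-comm to -‿+-comm)
open import Algebra.Properties.CommutativeMonoid.Mult +-commutativeMonoid using (×-distrib-+)
open import Algebra.Properties.CommutativeSemigroup +-commutativeSemigroup using () renaming (interchange to +-interchange)
open import Algebra.Properties.CommutativeSemigroup *-commutativeSemigroup using () renaming (interchange to *-interchange; x∙yz≈y∙xz to *-left-comm)
open import Algebra.Properties.Semiring.Mult semiring using (×-homo-+; ×-congˡ; ×-congʳ; ×-comm-*; ×-assoc-*; ×-assocˡ)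
open import Algebra.Properties.Semiring.Sum semiring using (sum-cong-≋; ∑-distrib-+; *-distribˡ-sum; *-distribʳ-sum)
open import Relation.Binary.Reasoning.Setoid setoid
open BinomialSum commutativeSemiring

-- Termwise equal representatives are equal as reals. For explicit rational constants both premises
-- then hold by computation.
≈-pointwise : ∀ {z w} → (∀ n → ℝ.seq (ℂ.re z) n ≡ ℝ.seq (ℂ.re w) n) → (∀ n → ℝ.seq (ℂ.im z) n ≡ ℝ.seq (ℂ.im w) n) → z ≈ w
≈-pointwise re≡ im≡ = record { re-≈ = ≈ᴿ-pointwise re≡ ; im-≈ = ≈ᴿ-pointwise im≡ }

-- Products of exponential generating functions.

-- The left side is multiplied by n! · 1/n! = 1, n! is factored as C(n,k) k! m!, and k! and m!
-- cancel against their reciprocals.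
1/m!*1/k!≈nCk·1/n! : ∀ {n k} → k ≤ n → (1/ (n ∸ k) !) * (1/ k !) ≈ (n C k) · (1/ n !)
1/m!*1/k!≈nCk·1/n! {n} {k} k≤n = begin
  u * v                                         ≈⟨ *-identityʳ _ ⟨
  u * v * 1#                                    ≈⟨ *-congˡ (n!·1/n!≈1 n) ⟨
  u * v * ((n !) · w)                           ≈⟨ *-congˡ (×-congˡ (nCk*[k![n∸k]!]≡n! k≤n)) ⟨
  u * v * (((n C k) ℕ.* (k ! ℕ.* m !)) · w)     ≈⟨ *-congˡ (×-assocˡ w (n C k) (k ! ℕ.* m !)) ⟨
  u * v * ((n C k) · ((k ! ℕ.* m !) · w))       ≈⟨ ×-comm-* (n C k) (u * v) _ ⟩
  (n C k) · (u * v * ((k ! ℕ.* m !) · w))       ≈⟨ ×-congʳ (n C k) cancel ⟩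
  (n C k) · w                                   ∎
  where
  m : ℕ
  m = n ∸ k
  u v w : ℂ
  u = 1/ m !
  v = 1/ k !
  w = 1/ n !
  cancel : u * v * ((k ! ℕ.* m !) · w) ≈ w
  cancel = begin
    u * v * ((k ! ℕ.* m !) · w)         ≈⟨ *-congˡ (×-assocˡ w (k !) (m !)) ⟨
    u * v * ((k !) · ((m !) · w))       ≈⟨ *-assoc u v _ ⟩
    u * (v * ((k !) · ((m !) · w)))     ≈⟨ *-congˡ (trans (×-comm-* (k !) v _) (sym (×-assoc-* (k !) v _))) ⟩
    u * (((k !) · v) * ((m !) · w))     ≈⟨ *-congˡ (trans (*-congʳ (n!·1/n!≈1 k)) (*-identityˡ _)) ⟩
    u * ((m !) · w)                     ≈⟨ trans (×-comm-* (m !) u _) (sym (×-assoc-* (m !) u _)) ⟩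
    ((m !) · u) * w                     ≈⟨ trans (*-congʳ (n!·1/n!≈1 m)) (*-identityˡ _) ⟩
    w                                   ∎

egf-⋆ : ∀ a b → egf a ⊛ egf b ≋ egf (a ⋆ b)
egf-⋆ a b n = trans (sum-cong-≋ {suc n} step) (sym (*-distribʳ-sum (1/ n !) (term (λ m k → a m * b k) n)))
  where
  step : ∀ k → egf a (n ∸ toℕ k) * egf b (toℕ k) ≈ ((n C toℕ k) · (a (n ∸ toℕ k) * b (toℕ k))) * 1/ n !
  step k = begin
    (a m * 1/ m !) * (b j * 1/ j !)     ≈⟨ *-interchange _ _ _ _ ⟩
    (a m * b j) * (1/ m ! * 1/ j !)     ≈⟨ *-congˡ (1/m!*1/k!≈nCk·1/n! (toℕ≤pred[n] k)) ⟩
    (a m * b j) * ((n C j) · 1/ n !)    ≈⟨ ×-comm-* (n C j) _ _ ⟩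
    (n C j) · (a m * b j * 1/ n !)      ≈⟨ ×-assoc-* (n C j) _ _ ⟨
    ((n C j) · (a m * b j)) * 1/ n !    ∎
    where
    j m : ℕ
    j = toℕ k
    m = n ∸ j

-- Degenerate falling factorials and the exponential law.

fall-cong : ∀ ƛ {z w} → z ≈ w → ∀ n → fall ƛ z n ≈ fall ƛ w n
fall-cong ƛ z≈w zero    = refl
fall-cong ƛ z≈w (suc n) = *-cong (fall-cong ƛ z≈w n) (+-congʳ z≈w)

-- An instance of `vandermonde` whose factors are z - mλ, w - kλ and z + w - nλ; `shift` is their
-- additivity.
fall-+ : ∀ ƛ z w n → (fall ƛ z ⋆ fall ƛ w) n ≈ fall ƛ (z + w) n
fall-+ ƛ z w = vandermonde {fall ƛ z} {fall ƛ w} {fall ƛ (z + w)} refl refl refl (λ _ → refl) (λ _ → refl) (λ _ → refl) shift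
  where
  l : ℂ
  l = fromℝ ƛ
  shift : ∀ m k → (z + w) - (m ℕ.+ k) · l ≈ (z - m · l) + (w - k · l)
  shift m k = begin
    (z + w) - (m ℕ.+ k) · l            ≈⟨ +-congˡ (-‿cong (×-homo-+ l m k)) ⟩
    (z + w) - (m · l + k · l)          ≈⟨ +-congˡ (-‿+-comm (m · l) (k · l)) ⟨
    (z + w) + (- (m · l) + - (k · l))  ≈⟨ +-interchange z w _ _ ⟩
    (z - m · l) + (w - k · l)          ∎

-- The law that degenerate exponentials multiply by adding exponents, read off at tⁿ/n!.
egf⁻¹-dexp : ∀ ƛ z w n → egf⁻¹ (dexp ƛ z ⊛ dexp ƛ w) n ≈ fall ƛ (z + w) n
egf⁻¹-dexp ƛ z w n = begin
  egf⁻¹ (dexp ƛ z ⊛ dexp ƛ w) n        ≈⟨ ×-congʳ (n !) (egf-⋆ (fall ƛ z) (fall ƛ w) n) ⟩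
  egf⁻¹ (egf (fall ƛ z ⋆ fall ƛ w)) n  ≈⟨ egf⁻¹-egf (fall ƛ z ⋆ fall ƛ w) n ⟩
  (fall ƛ z ⋆ fall ƛ w) n              ≈⟨ fall-+ ƛ z w n ⟩
  fall ƛ (z + w) n                     ∎

-- Linearity, and closed forms of `𝐂` and `𝐒`.

⊛-linear : ∀ f {c d g₁ g₂ g} → g ≋ c ⊙ g₁ ⊕ d ⊙ g₂ → f ⊛ g ≋ c ⊙ (f ⊛ g₁) ⊕ d ⊙ (f ⊛ g₂)
⊛-linear f {c} {d} {g₁} {g₂} {g} g≋ n = begin
  (f ⊛ g) n
    ≈⟨ sum-cong-≋ {suc n} split ⟩
  ∑[ k ≤ n ] (c * t g₁ k + d * t g₂ k)
    ≈⟨ ∑-distrib-+ (λ k → c * t g₁ k) (λ k → d * t g₂ k) ⟩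
  (∑[ k ≤ n ] (c * t g₁ k)) + (∑[ k ≤ n ] (d * t g₂ k))
    ≈⟨ +-cong (*-distribˡ-sum c (t g₁)) (*-distribˡ-sum d (t g₂)) ⟨
  c * (f ⊛ g₁) n + d * (f ⊛ g₂) n ∎
  where
  t : PowerSeries → Fin (suc n) → ℂ
  t h k = f (n ∸ toℕ k) * h (toℕ k)
  split : ∀ k → t g k ≈ c * t g₁ k + d * t g₂ k
  split k = trans (*-congˡ (g≋ (toℕ k))) (trans (distribˡ _ _ _) (+-cong (*-left-comm _ c _) (*-left-comm _ d _)))

egf⁻¹-linear : ∀ {c d f g h} → h ≋ c ⊙ f ⊕ d ⊙ g → ∀ n → egf⁻¹ h n ≈ c * egf⁻¹ f n + d * egf⁻¹ g n
egf⁻¹-linear {c} {d} {f} {g} h≋ n = begin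
  _                                      ≈⟨ ×-congʳ (n !) (h≋ n) ⟩
  (n !) · (c * f n + d * g n)            ≈⟨ ×-distrib-+ _ _ (n !) ⟩
  (n !) · (c * f n) + (n !) · (d * g n)  ≈⟨ +-cong (×-comm-* (n !) c _) (×-comm-* (n !) d _) ⟨
  c * egf⁻¹ f n + d * egf⁻¹ g n          ∎

_+i_ _-i_ : ℝ → ℝ → ℂ
x +i y = fromℝ x + i * fromℝ y
x -i y = fromℝ x + - (i * fromℝ y)

-- Common source of the closed forms: `dcos` and `dsin` are both combinations of the same two
-- exponentials, and multiplying these by the exponential of x moves their exponents to x ± iy.
egf⁻¹-dexp-linear : ∀ ƛ x y {c d g} → g ≋ c ⊙ dexp ƛ (i * fromℝ y) ⊕ d ⊙ dexp ƛ (- (i * fromℝ y)) →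
                    ∀ n → egf⁻¹ (dexp ƛ (fromℝ x) ⊛ g) n ≈ c * fall ƛ (x +i y) n + d * fall ƛ (x -i y) n
egf⁻¹-dexp-linear ƛ x y g≋ n = trans
  (egf⁻¹-linear (⊛-linear (dexp ƛ (fromℝ x)) g≋) n)
  (+-cong (*-congˡ (egf⁻¹-dexp ƛ _ _ n)) (*-congˡ (egf⁻¹-dexp ƛ _ _ n)))

𝐂-fall : ∀ ƛ x y n → 𝐂 ƛ n x y ≈ 1/2 * fall ƛ (x +i y) n + 1/2 * fall ƛ (x -i y) n
𝐂-fall ƛ x y = egf⁻¹-dexp-linear ƛ x y λ n → distribˡ 1/2 _ _

𝐒-fall : ∀ ƛ x y n → 𝐒 ƛ n x y ≈ 1/2i * fall ƛ (x +i y) n + - 1/2i * fall ƛ (x -i y) n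
𝐒-fall ƛ x y = egf⁻¹-dexp-linear ƛ x y λ n →
  -- The minus sign in `dsin` sits on the second exponential and is moved onto the scalar.
  trans (distribˡ 1/2i _ _) (+-congˡ (trans (sym (-‿distribʳ-* 1/2i _)) (-‿distribˡ-* 1/2i _)))

-- `∑C-diagonal` lives in a semiring and adds its two products, so the minus sign of - S S′ has to
-- be absorbed into the coefficients of the first factor.
-𝐒-fall : ∀ ƛ x y n → - 𝐒 ƛ n x y ≈ - 1/2i * fall ƛ (x +i y) n + 1/2i * fall ƛ (x -i y) n
-𝐒-fall ƛ x y n = begin
  - 𝐒 ƛ n x y                    ≈⟨ -‿cong (𝐒-fall ƛ x y n) ⟩
  - (1/2i * p + - 1/2i * q)      ≈⟨ -‿+-comm _ _ ⟨
  - (1/2i * p) + - (- 1/2i * q)  ≈⟨ +-cong (-‿distribˡ-* 1/2i p) (trans (-‿distribˡ-* (- 1/2i) q) (*-congʳ (-‿involutive 1/2i))) ⟩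
  - 1/2i * p + 1/2i * q          ∎
  where
  p q : ℂ
  p = fall ƛ (x +i y) n
  q = fall ƛ (x -i y) n

-- Additivity of x ± iy and the two addition formulas.

fromℝ-+ : ∀ x y → fromℝ (x +ᴿ y) ≈ fromℝ x + fromℝ y
fromℝ-+ x y = ≈-pointwise (λ _ → ≡.refl) (λ _ → ≡.refl)

i*fromℝ-+ : ∀ x y → i * fromℝ (x +ᴿ y) ≈ i * fromℝ x + i * fromℝ y
i*fromℝ-+ x y = trans (*-congˡ (fromℝ-+ x y)) (distribˡ i _ _)

+i-homo-+ : ∀ x₁ x₂ y₁ y₂ → (x₁ +i y₁) + (x₂ +i y₂) ≈ (x₁ +ᴿ x₂) +i (y₁ +ᴿ y₂)
+i-homo-+ x₁ x₂ y₁ y₂ = trans (+-interchange _ _ _ _) (sym (+-cong (fromℝ-+ x₁ x₂) (i*fromℝ-+ y₁ y₂)))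

-i-homo-+ : ∀ x₁ x₂ y₁ y₂ → (x₁ -i y₁) + (x₂ -i y₂) ≈ (x₁ +ᴿ x₂) -i (y₁ +ᴿ y₂)
-i-homo-+ x₁ x₂ y₁ y₂ = trans (+-interchange _ _ _ _)
  (sym (+-cong (fromℝ-+ x₁ x₂) (trans (-‿cong (i*fromℝ-+ y₁ y₂)) (sym (-‿+-comm _ _)))))

theorem7 : (ƛ : ℝ) → ¬ (ƛ ≈ᴿ 0ᴿ) →
    (x₁ x₂ y₁ y₂ : ℝ) (n : ℕ) →
    (𝐂 ƛ n (x₁ +ᴿ x₂) (y₁ +ᴿ y₂)
    ≈ ∑[ k ≤ n ] ((n C toℕ k) · (𝐂 ƛ (n ∸ toℕ k) x₁ y₁ * 𝐂 ƛ (toℕ k) x₂ y₂ - 𝐒 ƛ (n ∸ toℕ k) x₁ y₁ * 𝐒 ƛ (toℕ k) x₂ y₂)))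
    × (𝐒 ƛ n (x₁ +ᴿ x₂) (y₁ +ᴿ y₂)
    ≈ ∑[ k ≤ n ] ((n C toℕ k) · (𝐒 ƛ (n ∸ toℕ k) x₁ y₁ * 𝐂 ƛ (toℕ k) x₂ y₂ + 𝐂 ƛ (n ∸ toℕ k) x₁ y₁ * 𝐒 ƛ (toℕ k) x₂ y₂)))
theorem7 ƛ _ x₁ x₂ y₁ y₂ n = sym 𝐂-sum , sym 𝐒-sum
  where
  P₁ P₂ M₁ M₂ : ℕ → ℂ
  P₁ = fall ƛ (x₁ +i y₁)
  P₂ = fall ƛ (x₂ +i y₂)
  M₁ = fall ƛ (x₁ -i y₁)
  M₂ = fall ƛ (x₂ -i y₂)
  P⋆P : (P₁ ⋆ P₂) n ≈ fall ƛ ((x₁ +ᴿ x₂) +i (y₁ +ᴿ y₂)) n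
  P⋆P = trans (fall-+ ƛ _ _ n) (fall-cong ƛ (+i-homo-+ x₁ x₂ y₁ y₂) n)
  M⋆M : (M₁ ⋆ M₂) n ≈ fall ƛ ((x₁ +ᴿ x₂) -i (y₁ +ᴿ y₂)) n
  M⋆M = trans (fall-+ ƛ _ _ n) (fall-cong ƛ (-i-homo-+ x₁ x₂ y₁ y₂) n)
  𝐂-sum : ∑C (λ m k → 𝐂 ƛ m x₁ y₁ * 𝐂 ƛ k x₂ y₂ - 𝐒 ƛ m x₁ y₁ * 𝐒 ƛ k x₂ y₂) n ≈ 𝐂 ƛ n (x₁ +ᴿ x₂) (y₁ +ᴿ y₂)
  𝐂-sum = begin
    ∑C (λ m k → 𝐂 ƛ m x₁ y₁ * 𝐂 ƛ k x₂ y₂ - 𝐒 ƛ m x₁ y₁ * 𝐒 ƛ k x₂ y₂) n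
      ≈⟨ ∑C-cong (λ m k → +-cong (*-cong (𝐂-fall ƛ x₁ y₁ m) (𝐂-fall ƛ x₂ y₂ k))
           (trans (-‿distribˡ-* _ _) (*-cong (-𝐒-fall ƛ x₁ y₁ m) (𝐒-fall ƛ x₂ y₂ k)))) n ⟩
    ∑C (λ m k → (1/2 * P₁ m + 1/2 * M₁ m) * (1/2 * P₂ k + 1/2 * M₂ k) + (- 1/2i * P₁ m + 1/2i * M₁ m) * (1/2i * P₂ k + - 1/2i * M₂ k)) n
      -- With (1/2i)² = -1/4, the coefficients of PP′ and MM′ are 1/4 + 1/4 = 1/2, and those of the
      -- mixed products are 1/4 - 1/4 = 0.
      ≈⟨ ∑C-diagonal P₁ M₁ P₂ M₂
           (≈-pointwise (λ _ → ≡.refl) (λ _ → ≡.refl)) (≈-pointwise (λ _ → ≡.refl) (λ _ → ≡.refl))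
           (≈-pointwise (λ _ → ≡.refl) (λ _ → ≡.refl)) (≈-pointwise (λ _ → ≡.refl) (λ _ → ≡.refl)) n ⟩
    1/2 * (P₁ ⋆ P₂) n + 1/2 * (M₁ ⋆ M₂) n
      ≈⟨ +-cong (*-congˡ P⋆P) (*-congˡ M⋆M) ⟩
    1/2 * fall ƛ ((x₁ +ᴿ x₂) +i (y₁ +ᴿ y₂)) n + 1/2 * fall ƛ ((x₁ +ᴿ x₂) -i (y₁ +ᴿ y₂)) n
      ≈⟨ 𝐂-fall ƛ _ _ n ⟨
    𝐂 ƛ n (x₁ +ᴿ x₂) (y₁ +ᴿ y₂) ∎
  𝐒-sum : ∑C (λ m k → 𝐒 ƛ m x₁ y₁ * 𝐂 ƛ k x₂ y₂ + 𝐂 ƛ m x₁ y₁ * 𝐒 ƛ k x₂ y₂) n ≈ 𝐒 ƛ n (x₁ +ᴿ x₂) (y₁ +ᴿ y₂)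
  𝐒-sum = begin
    ∑C (λ m k → 𝐒 ƛ m x₁ y₁ * 𝐂 ƛ k x₂ y₂ + 𝐂 ƛ m x₁ y₁ * 𝐒 ƛ k x₂ y₂) n
      ≈⟨ ∑C-cong (λ m k → +-cong (*-cong (𝐒-fall ƛ x₁ y₁ m) (𝐂-fall ƛ x₂ y₂ k)) (*-cong (𝐂-fall ƛ x₁ y₁ m) (𝐒-fall ƛ x₂ y₂ k))) n ⟩
    ∑C (λ m k → (1/2i * P₁ m + - 1/2i * M₁ m) * (1/2 * P₂ k + 1/2 * M₂ k) + (1/2 * P₁ m + 1/2 * M₁ m) * (1/2i * P₂ k + - 1/2i * M₂ k)) n
      -- Both halves contribute ½ · (1/2i) to PP′ and its negative to MM′; on the mixed products
      -- they have opposite signs and cancel.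
      ≈⟨ ∑C-diagonal P₁ M₁ P₂ M₂
           (≈-pointwise (λ _ → ≡.refl) (λ _ → ≡.refl)) (≈-pointwise (λ _ → ≡.refl) (λ _ → ≡.refl))
           (≈-pointwise (λ _ → ≡.refl) (λ _ → ≡.refl)) (≈-pointwise (λ _ → ≡.refl) (λ _ → ≡.refl)) n ⟩
    1/2i * (P₁ ⋆ P₂) n + - 1/2i * (M₁ ⋆ M₂) n
      ≈⟨ +-cong (*-congˡ P⋆P) (*-congˡ M⋆M) ⟩
    1/2i * fall ƛ ((x₁ +ᴿ x₂) +i (y₁ +ᴿ y₂)) n + - 1/2i * fall ƛ ((x₁ +ᴿ x₂) -i (y₁ +ᴿ y₂)) n
      ≈⟨ 𝐒-fall ƛ _ _ n ⟨
    𝐒 ƛ n (x₁ +ᴿ x₂) (y₁ +ᴿ y₂) ∎
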